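{- For all sufficiently large $k$, $\#\mathrm{ndetBstates}^3_2(k)\ge k^{2.5}$.
   Context: $T^3_2$ is the balanced rooted binary tree with 3 levels (7 nodes). An instance with parameter $k$ assigns to each of the 3 internal nodes $i$ a function $f_i:[k]^2\to[k]$ (given by its $k^2$ values) and to each of the 4 leaves an element of $[k]=\{1,\dots,k\}$; $v_i$ is the leaf label for a leaf and $v_i=f_i(\text{values of its two children})$ otherwise. $BT^3_2(k)$: decide whether the root value is $1$; its $k$-ary input variables are $f_i(a,b)$ and one per leaf. A nondeterministic $k$-way branching program computing $g:[k]^m\to R$ is a directed rooted multigraph of states, edges labelled by elements of $[k]$, nonfinal states labelled by variable indices, $|R|$ final sink states labelled by elements of $R$; on input $x$, edges labelled $x_j$ out of states labelled $j$ are activated; each computation (path of activated edges from the root) is infinite, ends in the final state labelled $g(x)$, or aborts at a state labelled $j$ with no outedge labelled $x_j$, and at least one ends in a final state. $\#\mathrm{ndetBstates}^3_2(k)$ is the minimum number of states of such a program solving $BT^3_2(k)$. -}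

module Defs where

open import Data.Nat using (ℕ)
open import Data.Fin using (Fin; zero; suc)
open import Data.Bool using (Bool; true; false)
open import Data.Sum using (_⊎_; inj₁; inj₂)
open import Data.Product using (_×_; _,_; Σ; ∃)
open import Data.List using (List)
open import Data.List.Membership.Propositional using (_∈_)
open import Relation.Binary.PropositionalEquality using (_≡_)
open import Relation.Nullary using (¬_)

-- The tree evaluation problem BT^3_2(k).
-- [k] = {1,…,k} is represented by Fin k, the value i+1 by the Fin index i;
-- so "root value is 1" means "root value is the Fin index zero".
-- Nodes are numbered in heap order: 1 root; 2,3 its children; 4,5 children
-- of 2; 6,7 children of 3.  Internal nodes: Fin 3 (0 ↦ node 1, 1 ↦ node 2,
-- 2 ↦ node 3); leaves: Fin 4 (0 ↦ node 4, …, 3 ↦ node 7).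

data BTVar (k : ℕ) : Set where
  fvar : Fin 3 → Fin k → Fin k → BTVar k
  leaf : Fin 4 → BTVar k

n1 n2 n3 : Fin 3
n1 = zero
n2 = suc zero
n3 = suc (suc zero)

rootValue : {k : ℕ} → (BTVar k → Fin k) → Fin k
rootValue x =
  let v4 = x (leaf zero)
      v5 = x (leaf (suc zero))
      v6 = x (leaf (suc (suc zero)))
      v7 = x (leaf (suc (suc (suc zero))))
      v2 = x (fvar n2 v4 v5)
      v3 = x (fvar n3 v6 v7)
  in x (fvar n1 v2 v3)

isOne : {k : ℕ} → Fin k → Bool
isOne zero    = true
isOne (suc _) = false

BT : (k : ℕ) → (BTVar k → Fin k) → Bool
BT k x = isOne (rootValue x)

-- Nondeterministic k-way branching programs computing g : [k]^V → R.
-- States are Fin nStates.  Each state is either nonfinal (labelled by a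
-- variable, inj₁) or final (labelled by an element of R, inj₂).  Edges are
-- a list (multiset) of triples (source, label, target).

record NBP (V : Set) (k : ℕ) (R : Set) : Set where
  field
    nStates : ℕ
    root    : Fin nStates
    label   : Fin nStates → V ⊎ R
    edges   : List (Fin nStates × Fin k × Fin nStates)
    finalExists : (r : R) → ∃ λ s → label s ≡ inj₂ r
    finalUnique : (r : R) (s t : Fin nStates) →
                  label s ≡ inj₂ r → label t ≡ inj₂ r → s ≡ t
    finalSink   : (s : Fin nStates) (a : Fin k) (t : Fin nStates) →
                  (s , a , t) ∈ edges → (r : R) → ¬ (label s ≡ inj₂ r)

open NBP public

data Reach {V : Set} {k : ℕ} {R : Set} (P : NBP V k R) (x : V → Fin k) :
           Fin (nStates P) → Set where
  start : Reach P x (root P)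
  step  : {s t : Fin (nStates P)} {a : Fin k} {j : V} →
          Reach P x s → (s , a , t) ∈ edges P →
          label P s ≡ inj₁ j → x j ≡ a → Reach P x t

-- P computes g: on every input some computation ends in the final state
-- labelled g(x), and no computation ends in a final state labelled otherwise
-- (other computations are infinite or abort).
Computes : {V : Set} {k : ℕ} {R : Set} → NBP V k R → ((V → Fin k) → R) → Set
Computes {V} {k} {R} P g =
  (x : V → Fin k) →
    (Σ (Fin (nStates P)) λ s → Reach P x s × label P s ≡ inj₂ (g x))
    × ((s : Fin (nStates P)) (r : R) → Reach P x s → label P s ≡ inj₂ r → r ≡ g x)

{-# OPTIONS --safe #-}
module Submission where

-- Nečiporuk's argument.  Fix the leaves to r,s,r,s and let f₁ = F range over
-- the 0/1-valued functions.  Of the two variables u = f₂(r,s) and v = f₃(r,s)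
-- the program can learn the pair (a,b) at which F is evaluated only in the p
-- states querying u and the q states querying v.  Between two such queries the
-- computation depends on F and on the last answer only; composing consecutive
-- queries of the same variable, F is determined by the sets
--   { t ∈ {acc} ∪ U ∪ V : t is reached from the root without using a or b },
--   { t ∈ {acc} ∪ V : t is reached from σ ∈ U using only the answer u = a },
-- and the sets of the second kind with u and v exchanged.  Hence
--   k² ≤ (1 + p + q) + kp(1 + q) + kq(1 + p),
-- whose main term 2kpq is at most k(p + q)²/2.  The factor 1/2, due to treating
-- u and v separately, absorbs the lower order terms and gives (p + q)² ≥ k.
-- These state sets are disjoint for distinct (r,s).

open import Defs
open import Data.Nat using (ℕ; zero; suc; _+_; _*_; _^_; _≤_; _<_; z≤n; s≤s; _≤?_; >-nonZero)
open import Data.Nat.Properties hiding (_≟_)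
open import Data.Nat.Tactic.RingSolver using (solve-∀)
open import Data.Fin using (Fin; zero; suc; combine; remQuot; inject≤; funToFin; finToFun)
import Data.Fin.Properties as Fin
open import Data.Bool using (Bool; true; if_then_else_)
import Data.Bool.Properties as Bool
open import Data.Empty using (⊥-elim)
open import Data.List using (List; []; _∷_; _++_; map; length; lookup; filter; allFin; cartesianProduct; cartesianProductWith)
open import Data.List.Properties using (length-++; length-map; length-tabulate)
open import Data.List.Membership.Propositional using (_∈_)
open import Data.List.Membership.Propositional.Properties
import Data.List.Relation.Unary.All as All
open import Data.List.Relation.Unary.Any using (here; there; index)
open import Data.List.Relation.Unary.Any.Properties using (lookup-index)
open import Data.List.Relation.Unary.AllPairs using ([]; _∷_)
open import Data.List.Relation.Unary.Unique.Propositional using (Unique)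
import Data.List.Relation.Unary.Unique.Propositional.Properties as Unique
open import Data.Product using (∃; ∃₂; _×_; _,_; proj₁; proj₂; uncurry)
open import Data.Sum using (inj₁; inj₂; [_,_]′)
open import Data.Sum.Properties using (inj₁-injective) renaming (≡-dec to ⊎-≡-dec)
open import Effect.Monad using (RawMonad)
open import Function using (_∘_)
open import Function.Bundles using (_⇔_; mk⇔; Equivalence)
open import Relation.Binary.Construct.Closure.ReflexiveTransitive using (Star; ε; _◅_; _◅◅_)
open import Relation.Binary.Definitions using (DecidableEquality)
open import Relation.Binary.PropositionalEquality
open import Relation.Nullary using (¬_; Dec; yes; no; does; contradiction; map′; ¬¬-excluded-middle)
open import Relation.Nullary.Decidable using (_×-dec_; dec-true)
open import Relation.Nullary.Negation using (¬¬-Monad)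

-- Counting

-- Double negations over a finite index set are discharged one index at a time, so excluded middle
-- becomes available for finitely many propositions at once.
∀-¬¬-commute : ∀ {n} {A : Fin n → Set} → (∀ i → ¬ ¬ A i) → ¬ ¬ (∀ i → A i)
∀-¬¬-commute = Fin.sequence (RawMonad.rawApplicative ¬¬-Monad)

bit : {A : Set} → Dec A → Fin 2
bit (yes _) = suc zero
bit (no _)  = zero

bit-≡⇒→ : {A B : Set} (A? : Dec A) (B? : Dec B) → bit A? ≡ bit B? → A → B
bit-≡⇒→ (yes _) (yes b) _ _ = b
bit-≡⇒→ (no ¬a) _       _ a = contradiction a ¬a

funToFin-injective : ∀ {m n} (f g : Fin m → Fin n) → funToFin f ≡ funToFin g → f ≗ g
funToFin-injective f g eq i =
  trans (sym (Fin.finToFun-funToFin f i))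
        (trans (cong (λ c → finToFun c i) eq) (Fin.finToFun-funToFin g i))

funToFin-cong : ∀ {m n} {f g : Fin m → Fin n} → f ≗ g → funToFin f ≡ funToFin g
funToFin-cong {zero}  f≗g = refl
funToFin-cong {suc m} f≗g = cong₂ combine (f≗g zero) (funToFin-cong (f≗g ∘ suc))

finToFun-injective : ∀ {m n} (i j : Fin (n ^ m)) →
                     finToFun {n} {m} i ≗ finToFun j → i ≡ j
finToFun-injective {m} {n} i j eq =
  trans (sym (Fin.funToFin-finToFin {m} {n} i))
        (trans (funToFin-cong eq) (Fin.funToFin-finToFin {m} {n} j))

-- Q will be reachability, for which no decision procedure is built; a collision
-- under ¬¬ suffices because the final inequality is stable.
¬¬-collision : ∀ {I : Set} {m} (Q : Fin (2 ^ m) → I → Set) (L : List I) → length L < m →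
               ¬ ¬ ∃₂ λ i j → i ≢ j × (∀ l → l ∈ L → Q i l ⇔ Q j l)
¬¬-collision Q L L<m ¬col =
  ∀-¬¬-commute (λ i → ∀-¬¬-commute λ l → ¬¬-excluded-middle {A = Q i (lookup L l)}) collide
  where
  collide : ¬ (∀ i l → Dec (Q i (lookup L l)))
  -- Only `2 ^ length L` patterns of truth values along `L` are possible, fewer than the `2 ^ m`
  -- indices.
  collide Q? with Fin.pigeonhole (^-monoʳ-< 2 ≤-refl L<m) (λ i → funToFin (bit ∘ Q? i))
  ... | i , j , i<j , eq = ¬col (i , j , Fin.<⇒≢ i<j , agree)
    where
    agree : ∀ l → l ∈ L → Q i l ⇔ Q j l
    agree l l∈L rewrite lookup-index l∈L =
      let x   = index l∈L
          eqₓ = funToFin-injective (bit ∘ Q? i) (bit ∘ Q? j) eq x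
      in mk⇔ (bit-≡⇒→ (Q? i x) (Q? j x) eqₓ) (bit-≡⇒→ (Q? j x) (Q? i x) (sym eqₓ))

lookup-injective : ∀ {A : Set} {xs : List A} → Unique xs →
                   ∀ i j → lookup xs i ≡ lookup xs j → i ≡ j
lookup-injective (_ ∷ _)   zero    zero    _  = refl
lookup-injective (x∉ ∷ _)  zero    (suc j) eq = ⊥-elim (All.lookup x∉ (∈-lookup j) eq)
lookup-injective (x∉ ∷ _)  (suc i) zero    eq = ⊥-elim (All.lookup x∉ (∈-lookup i) (sym eq))
lookup-injective (_ ∷ uxs) (suc i) (suc j) eq = cong suc (lookup-injective uxs i j eq)

-- The first `t` entries of each list inject `Fin c × Fin t` into `Fin n`: disjointness recovers the
-- list, uniqueness the position.
disjoint-lists-bound : ∀ {c n t} (L : Fin c → List (Fin n)) → (∀ i → Unique (L i)) →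
                       (∀ i j x → x ∈ L i → x ∈ L j → i ≡ j) →
                       (∀ i → t ≤ length (L i)) → c * t ≤ n
disjoint-lists-bound {c} {n} {t} L unique disjoint t≤ = Fin.injective⇒≤ {f = pick ∘ remQuot t} inj
  where
  pick : Fin c × Fin t → Fin n
  pick (i , a) = lookup (L i) (inject≤ a (t≤ i))

  pick-injective : ∀ x y → pick x ≡ pick y → x ≡ y
  pick-injective (i , a) (j , b) eq
    with refl ← disjoint i j _ (∈-lookup (inject≤ a (t≤ i)))
                  (subst (_∈ L j) (sym eq) (∈-lookup (inject≤ b (t≤ j))))
    = cong (i ,_) (Fin.inject≤-injective (t≤ i) (t≤ i) a b (lookup-injective (unique i) _ _ eq))

  inj : ∀ {x y} → pick (remQuot t x) ≡ pick (remQuot t y) → x ≡ y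
  inj {x} {y} eq = trans (sym (Fin.combine-remQuot {c} t x))
    (trans (cong (uncurry combine) (pick-injective _ _ eq)) (Fin.combine-remQuot {c} t y))

length-cartesianProductWith : ∀ {A B C : Set} (f : A → B → C) xs ys →
                              length (cartesianProductWith f xs ys) ≡ length xs * length ys
length-cartesianProductWith f []       ys = refl
length-cartesianProductWith f (x ∷ xs) ys =
  trans (length-++ (map (f x) ys))
        (cong₂ _+_ (length-map (f x) ys) (length-cartesianProductWith f xs ys))

isOne-inject≤ : ∀ {m n} (c : Fin m) (m≤n : m ≤ n) → isOne (inject≤ c m≤n) ≡ isOne c
isOne-inject≤ {n = suc _} zero    _ = refl
isOne-inject≤ {n = suc _} (suc _) _ = refl

isOne-injective : {c d : Fin 2} → isOne c ≡ isOne d → c ≡ d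
isOne-injective {zero}     {zero}     _ = refl
isOne-injective {suc zero} {suc zero} _ = refl

-- Branching programs restricted to two variables

module TwoVariables {V : Set} (_≟_ : DecidableEquality V) {k : ℕ} (P : NBP V k Bool) (u v : V) (u≢v : u ≢ v) where

  assign : (V → Fin k) → Fin k → Fin k → V → Fin k
  assign y a b j = if does (j ≟ u) then a else if does (j ≟ v) then b else y j

  assign-cong : ∀ y {a b a′ b′} j → (j ≡ u → a ≡ a′) → (j ≡ v → b ≡ b′) →
                assign y a b j ≡ assign y a′ b′ j
  assign-cong y j au bv with j ≟ u
  ... | yes j≡u = au j≡u
  ... | no _ with j ≟ v
  ...   | yes j≡v = bv j≡v
  ...   | no _    = refl

  State : Set
  State = Fin (nStates P)

  acc : State
  acc = proj₁ (finalExists P true)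

  queries? : ∀ w s → Dec (label P s ≡ inj₁ w)
  queries? w s = ⊎-≡-dec _≟_ Bool._≟_ (label P s) (inj₁ w)

  querying : V → List State
  querying w = filter (queries? w) (allFin (nStates P))

  ∈-querying⁺ : ∀ {w s} → label P s ≡ inj₁ w → s ∈ querying w
  ∈-querying⁺ {w} {s} eq = ∈-filter⁺ (queries? w) (∈-allFin s) eq

  ∈-querying⁻ : ∀ {w s} → s ∈ querying w → label P s ≡ inj₁ w
  ∈-querying⁻ {w} s∈ = proj₂ (∈-filter⁻ (queries? w) {xs = allFin (nStates P)} s∈)

  querying-unique : ∀ w → Unique (querying w)
  querying-unique w = Unique.filter⁺ (queries? w) (Unique.allFin⁺ (nStates P))

  -- Computation segments under partial knowledge of `u` and `v`.

  data Origin : Set where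
    fromRoot    : Origin
    fromU fromV : State → Fin k → Origin

  source : Origin → State
  source fromRoot    = root P
  source (fromU s _) = s
  source (fromV s _) = s

  -- An origin keeps at most one of the two values and leaves the rest free, so quantifying over
  -- `Known o a b` ranges over all completions of what `o` knows.
  data Known : Origin → Fin k → Fin k → Set where
    none : ∀ {a b} → Known fromRoot a b
    u=   : ∀ {s a b} → Known (fromU s a) a b
    v=   : ∀ {s a b} → Known (fromV s b) a b

  -- The edge is activated whatever the values of u and v not known at the origin.
  Step : (V → Fin k) → Origin → State → State → Set
  Step y o s t = ∃₂ λ c j → (s , c , t) ∈ edges P × label P s ≡ inj₁ j ×
                            (∀ {a b} → Known o a b → assign y a b j ≡ c)

  Path : (V → Fin k) → Origin × State → Set
  Path y (o , t) = Star (Step y o) (source o) t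

  -- A segment ends where its knowledge runs out. From `fromU` a further query of `u` is still
  -- answerable, so `querying u` is left out, and symmetrically for `fromV`; this keeps terms in
  -- `p * p` and `q * q` out of the count.
  targets : Origin → List State
  targets fromRoot    = acc ∷ querying u ++ querying v
  targets (fromU _ _) = acc ∷ querying v
  targets (fromV _ _) = acc ∷ querying u

  rootProbes uProbes vProbes probes : List (Origin × State)
  rootProbes = map (fromRoot ,_) (targets fromRoot)
  uProbes = cartesianProduct (cartesianProductWith fromU (querying u) (allFin k)) (acc ∷ querying v)
  vProbes = cartesianProduct (cartesianProductWith fromV (querying v) (allFin k)) (acc ∷ querying u)
  probes = rootProbes ++ uProbes ++ vProbes

  p q : ℕ
  p = length (querying u)
  q = length (querying v)

  probeBound : ℕ
  probeBound = suc (p + q) + (p * k * suc q + q * k * suc p)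

  length-probes : length probes ≡ probeBound
  length-probes = begin
    length probes
      ≡⟨ trans (length-++ rootProbes) (cong (length rootProbes +_) (length-++ uProbes)) ⟩
    length rootProbes + (length uProbes + length vProbes)
      ≡⟨ cong₂ _+_ length-rootProbes
                   (cong₂ _+_ (count fromU (querying u) (acc ∷ querying v))
                              (count fromV (querying v) (acc ∷ querying u))) ⟩
    probeBound ∎
    where
    open ≡-Reasoning
    length-rootProbes : length rootProbes ≡ suc (p + q)
    length-rootProbes = trans (length-map {B = Origin × State} (fromRoot ,_) (targets fromRoot))
                              (cong suc (length-++ (querying u) {querying v}))
    count : ∀ (f : State → Fin k → Origin) xs (ys : List State) →
            length (cartesianProduct (cartesianProductWith f xs (allFin k)) ys)
              ≡ length xs * k * length ys
    count f xs ys = trans (length-cartesianProductWith _,_ (cartesianProductWith f xs (allFin k)) ys)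
      (cong (_* length ys) (trans (length-cartesianProductWith f xs (allFin k))
                                  (cong (length xs *_) (length-tabulate (λ i → i)))))

  data Valid : Origin → Set where
    atRoot : Valid fromRoot
    atU    : ∀ {s a} → s ∈ querying u → Valid (fromU s a)
    atV    : ∀ {s b} → s ∈ querying v → Valid (fromV s b)

  ∈-probes : ∀ {o t} → Valid o → t ∈ targets o → (o , t) ∈ probes
  ∈-probes atRoot t∈ = ∈-++⁺ˡ (∈-map⁺ (fromRoot ,_) t∈)
  ∈-probes (atU s∈) t∈ = ∈-++⁺ʳ rootProbes (∈-++⁺ˡ
    (∈-cartesianProduct⁺ (∈-cartesianProductWith⁺ fromU s∈ (∈-allFin _)) t∈))
  ∈-probes (atV s∈) t∈ = ∈-++⁺ʳ rootProbes (∈-++⁺ʳ uProbes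
    (∈-cartesianProduct⁺ (∈-cartesianProductWith⁺ fromV s∈ (∈-allFin _)) t∈))

  acc∈targets : ∀ {o} → Valid o → acc ∈ targets o
  acc∈targets atRoot  = here refl
  acc∈targets (atU _) = here refl
  acc∈targets (atV _) = here refl

  -- Each step is activated under all completions of the origin's knowledge, in particular under the
  -- actual pair.
  follow : ∀ {y o a b s t} → Known o a b → Star (Step y o) s t →
           Reach P (assign y a b) s → Reach P (assign y a b) t
  follow kn ε                          reach = reach
  follow kn ((c , j , e , l , fix) ◅ π) reach = follow kn π (step reach e l (fix kn))

  -- Transfer of accepting computations between backgrounds.

  module Transfer {y y′ : V → Fin k}
                  (agree : ∀ l → l ∈ probes → Path y l → Path y′ l)
                  {a b : Fin k} where

    -- A y-computation arriving at t, whose part up to the last relevant query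
    -- has already been replaced by a y′-computation.
    record Tracked (t : State) : Set where
      constructor tracked
      field
        origin : Origin
        valid  : Valid origin
        known  : Known origin a b
        before : Reach P (assign y′ a b) (source origin)
        after  : Path y (origin , t)

    -- Agreement on the probe `(o , t)` swaps the `y`-segment for a `y′`-segment with the same ends.
    jump : ∀ {o t} → Valid o → Known o a b → Reach P (assign y′ a b) (source o) →
           Path y (o , t) → t ∈ targets o → Reach P (assign y′ a b) t
    jump val kn before π t∈ = follow kn (agree _ (∈-probes val t∈) π) before

    extend : ∀ {o s t c j} → Valid o → Known o a b → Reach P (assign y′ a b) (source o) →
             Path y (o , s) → (s , c , t) ∈ edges P → label P s ≡ inj₁ j →
             (∀ {a′ b′} → Known o a′ b′ → assign y a′ b′ j ≡ c) → Tracked t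
    extend val kn before π e l fix = tracked _ val kn before (π ◅◅ ((_ , _ , e , l , fix) ◅ ε))

    -- A query of a variable unknown at the origin closes the segment: `jump` replaces it, and the
    -- querying state with its answer becomes the new origin, forgetting any older answer. All other
    -- edges prolong the segment.
    advance : ∀ {s t c j} → Tracked s → (s , c , t) ∈ edges P →
              label P s ≡ inj₁ j → assign y a b j ≡ c → Tracked t
    advance {s} {t} {c} {j} (tracked o val kn before π) e l eq = go (j ≟ u) (j ≟ v) val kn before π
      where
      fixed : ∀ {a′ b′} → (j ≡ u → a′ ≡ a) → (j ≡ v → b′ ≡ b) → assign y a′ b′ j ≡ c
      fixed au bv = trans (assign-cong y j au bv) eq

      s∈querying : ∀ {w} → j ≡ w → s ∈ querying w
      s∈querying refl = ∈-querying⁺ l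

      go : ∀ {o} → Dec (j ≡ u) → Dec (j ≡ v) → Valid o → Known o a b →
           Reach P (assign y′ a b) (source o) → Path y (o , s) → Tracked t
      go (no j≢u) (no j≢v) val kn before π =
        extend val kn before π e l (λ _ → fixed (⊥-elim ∘ j≢u) (⊥-elim ∘ j≢v))
      go (yes j≡u) (yes j≡v) _ _ _ _ = ⊥-elim (u≢v (trans (sym j≡u) j≡v))
      go (yes j≡u) (no j≢v) val@(atU _) u= before π =
        extend val u= before π e l λ { u= → fixed (λ _ → refl) (⊥-elim ∘ j≢v) }
      go (yes j≡u) (no j≢v) atRoot kn before π =
        extend (atU (s∈querying j≡u)) u=
          (jump atRoot kn before π (there (∈-++⁺ˡ (s∈querying j≡u)))) ε e l
          λ { u= → fixed (λ _ → refl) (⊥-elim ∘ j≢v) }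
      go (yes j≡u) (no j≢v) val@(atV _) kn before π =
        extend (atU (s∈querying j≡u)) u= (jump val kn before π (there (s∈querying j≡u))) ε e l
          λ { u= → fixed (λ _ → refl) (⊥-elim ∘ j≢v) }
      go (no j≢u) (yes j≡v) val@(atV _) v= before π =
        extend val v= before π e l λ { v= → fixed (⊥-elim ∘ j≢u) (λ _ → refl) }
      go (no j≢u) (yes j≡v) atRoot kn before π =
        extend (atV (s∈querying j≡v)) v=
          (jump atRoot kn before π (there (∈-++⁺ʳ (querying u) (s∈querying j≡v)))) ε e l
          λ { v= → fixed (⊥-elim ∘ j≢u) (λ _ → refl) }
      go (no j≢u) (yes j≡v) val@(atU _) kn before π =
        extend (atV (s∈querying j≡v)) v= (jump val kn before π (there (s∈querying j≡v))) ε e l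
          λ { v= → fixed (⊥-elim ∘ j≢u) (λ _ → refl) }

    track : ∀ {t} → Reach P (assign y a b) t → Tracked t
    track start               = tracked fromRoot atRoot none start ε
    track (step reach e l eq) = advance (track reach) e l eq

    -- `acc` is a target of every origin, so the last segment can be replaced too.
    transfer : Reach P (assign y a b) acc → Reach P (assign y′ a b) acc
    transfer reach with tracked _ val kn before π ← track reach =
      jump val kn before π (acc∈targets val)


  module _ {g : (V → Fin k) → Bool} (computes : Computes P g) where

    accepts⁺ : ∀ x → g x ≡ true → Reach P x acc
    accepts⁺ x gx with (s , reach , l) , _ ← computes x =
      subst (Reach P x)
        (finalUnique P true s acc (trans l (cong inj₂ gx)) (proj₂ (finalExists P true))) reach

    accepts⁻ : ∀ x → Reach P x acc → g x ≡ true
    accepts⁻ x reach = sym (proj₂ (computes x) acc true reach (proj₂ (finalExists P true)))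

    probes-determine : ∀ {y y′} → (∀ l → l ∈ probes → Path y l ⇔ Path y′ l) →
                       ∀ a b → g (assign y a b) ≡ g (assign y′ a b)
    probes-determine {y} {y′} agree a b = Bool.⇔→≡ {z = true} (mk⇔
        (move λ l l∈ → Equivalence.to (agree l l∈))
        (move λ l l∈ → Equivalence.from (agree l l∈)))
      where
      move : ∀ {y y′} → (∀ l → l ∈ probes → Path y l → Path y′ l) →
             g (assign y a b) ≡ true → g (assign y′ a b) ≡ true
      move agree′ = accepts⁻ _ ∘ Transfer.transfer agree′ ∘ accepts⁺ _

    -- With fewer than `k * k` probes two distinct 0/1 tables would agree on all of them, hence give
    -- the same value at each `(a , b)`; but those values spell out the table.
    nečiporuk : (y : Fin (2 ^ (k * k)) → V → Fin k) →
                (∀ i a b → g (assign (y i) a b) ≡ isOne (finToFun {2} {k * k} i (combine a b))) →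
                k * k ≤ probeBound
    nečiporuk y realises = ≮⇒≥ λ small →
      ¬¬-collision (λ i → Path (y i)) probes (subst (_< k * k) (sym length-probes) small)
        λ (i , j , i≢j , agree) → i≢j (finToFun-injective {k * k} i j (same i j agree))
      where
      same : ∀ i j → (∀ l → l ∈ probes → Path (y i) l ⇔ Path (y j) l) →
             finToFun {2} {k * k} i ≗ finToFun j
      same i j agree ab with a , b , refl ← Fin.combine-surjective {k} {k} ab =
        isOne-injective (trans (sym (realises i a b))
          (trans (probes-determine agree a b) (realises j a b)))

-- Arithmetic

-- The two sides differ by the square of `d`, the gap between `m` and `n`.
4mn≤[m+n]² : ∀ m n → 4 * (m * n) ≤ (m + n) * (m + n)
4mn≤[m+n]² m n with ≤-total m n
... | inj₁ m≤n with d , refl ← m≤n⇒∃[o]m+o≡n m≤n =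
  subst (4 * (m * (m + d)) ≤_) (square m d) (m≤m+n _ (d * d))
  where
  square : ∀ m d → 4 * (m * (m + d)) + d * d ≡ (m + (m + d)) * (m + (m + d))
  square = solve-∀
... | inj₂ n≤m with d , refl ← m≤n⇒∃[o]m+o≡n n≤m =
  subst (4 * ((n + d) * n) ≤_) (square n d) (m≤m+n _ (d * d))
  where
  square : ∀ n d → 4 * ((n + d) * n) + d * d ≡ (n + d + n) * (n + d + n)
  square = solve-∀

-- For `m` at least 3, `2 + 2 * m ≤ m * m + 1` suffices. The threshold 6 comes from `m = 2`, where
-- `m * m < k` yields only `5 ≤ k`.
2+2m≤k : ∀ m {k} → 6 ≤ k → m * m < k → 2 + 2 * m ≤ k
2+2m≤k 0 6≤k _ = ≤-trans (s≤s (s≤s z≤n)) 6≤k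
2+2m≤k 1 6≤k _ = ≤-trans (s≤s (s≤s (s≤s (s≤s z≤n)))) 6≤k
2+2m≤k 2 6≤k _ = 6≤k
2+2m≤k (suc (suc (suc m))) 6≤k m²<k =
  ≤-trans (subst (2 + 2 * (3 + m) ≤_) (expand m) (m≤m+n _ (2 + 4 * m + m * m))) m²<k
  where
  expand : ∀ m → 2 + 2 * (3 + m) + (2 + 4 * m + m * m) ≡ suc ((3 + m) * (3 + m))
  expand = solve-∀

probeBound-small : ∀ p q k → 6 ≤ k → (p + q) * (p + q) < k →
                   suc (p + q) + (p * k * suc q + q * k * suc p) < k * k
probeBound-small p q k 6≤k m²<k = begin-strict
  suc (p + q) + (p * k * suc q + q * k * suc p) ≤⟨ +-monoˡ-≤ _ 1+m≤k ⟩
  k + (p * k * suc q + q * k * suc p)           ≡⟨ regroup p q k ⟩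
  k * (1 + (p + q) + 2 * (p * q))               <⟨ *-monoʳ-< k {{k≢0}} main ⟩
  k * k                                         ∎
  where
  open ≤-Reasoning
  k≢0 = >-nonZero (≤-trans (s≤s z≤n) 6≤k)
  m = p + q
  regroup : ∀ p q k → k + (p * k * suc q + q * k * suc p) ≡ k * (1 + (p + q) + 2 * (p * q))
  regroup = solve-∀
  linear : 2 + 2 * m ≤ k
  linear = 2+2m≤k m 6≤k m²<k
  1+m≤k : 1 + m ≤ k
  1+m≤k = ≤-trans (s≤s (≤-trans (m≤m+n m (m + 0)) (n≤1+n _))) linear
  double : ∀ m n → 2 * (1 + m + 2 * n) ≡ 2 + 2 * m + 4 * n
  double = solve-∀
  main : 1 + m + 2 * (p * q) < k
  -- Doubling produces `4 * (p * q)`, at most `m * m` and so below `k`; the other `k` absorbs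
  -- `2 + 2 * m`.
  main = *-cancelˡ-< 2 _ _ (begin-strict
    2 * (1 + m + 2 * (p * q)) ≡⟨ double m (p * q) ⟩
    2 + 2 * m + 4 * (p * q)   ≤⟨ +-mono-≤ linear (4mn≤[m+n]² p q) ⟩
    k + m * m                 <⟨ +-monoʳ-< k m²<k ⟩
    k + k                     ≡⟨ cong (k +_) (sym (+-identityʳ k)) ⟩
    2 * k                     ∎)

-- Rounding the root up keeps `k ≤ t * t`, so nothing is lost in the exponent; minimality turns
-- `k ≤ m * m` into `t ≤ m`.
⌈√_⌉ : ∀ k → ∃ λ t → k ≤ t * t × (∀ m → k ≤ m * m → t ≤ m)
⌈√ zero  ⌉ = 0 , z≤n , λ _ _ → z≤n
⌈√ suc k ⌉ with t , k≤t² , least ← ⌈√ k ⌉ with suc k ≤? t * t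
... | yes k<t² = t , k<t² , λ m k<m² → least m (<⇒≤ k<m²)
... | no  k≮t² = suc t , ≤-trans (s≤s k≤t²) (*-mono-< (n<1+n t) (n<1+n t)) ,
  λ m k<m² → ≰⇒> λ m≤t → k≮t² (≤-trans k<m² (*-mono-≤ m≤t m≤t))

-- Squaring expresses the exponent 2.5 within the naturals.
k⁵≤n² : ∀ k t n → k ≤ t * t → k * k * t ≤ n → k ^ 5 ≤ n ^ 2
k⁵≤n² k t n k≤t² k²t≤n = begin
  k ^ 5                     ≡⟨ power k ⟩
  k * k * (k * k) * k       ≤⟨ *-monoʳ-≤ (k * k * (k * k)) k≤t² ⟩
  k * k * (k * k) * (t * t) ≡⟨ square k t ⟩
  (k * k * t) ^ 2           ≤⟨ ^-monoˡ-≤ 2 k²t≤n ⟩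
  n ^ 2                     ∎
  where
  open ≤-Reasoning
  power : ∀ k → k * (k * (k * (k * (k * 1)))) ≡ k * k * (k * k) * k
  power = solve-∀
  square : ∀ k t → k * k * (k * k) * (t * t) ≡ k * k * t * (k * k * t * 1)
  square = solve-∀

-- Tree evaluation

fvar-injective : ∀ {k i i′} {r r′ s s′ : Fin k} → fvar i r s ≡ fvar i′ r′ s′ →
                 i ≡ i′ × r ≡ r′ × s ≡ s′
fvar-injective refl = refl , refl , refl

_≟ᵛ_ : ∀ {k} → DecidableEquality (BTVar k)
fvar i r s ≟ᵛ fvar i′ r′ s′ =
  map′ (λ { (refl , refl , refl) → refl }) fvar-injective
       (i Fin.≟ i′ ×-dec (r Fin.≟ r′ ×-dec s Fin.≟ s′))
fvar _ _ _ ≟ᵛ leaf _       = no λ ()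
leaf _     ≟ᵛ fvar _ _ _   = no λ ()
leaf l     ≟ᵛ leaf l′      = map′ (cong leaf) (λ { refl → refl }) (l Fin.≟ l′)

module _ {k′ : ℕ} (P : NBP (BTVar (2 + k′)) (2 + k′) Bool) (computes : Computes P (BT (2 + k′))) where

  private
    k : ℕ
    k = 2 + k′

  module _ (r s : Fin k) where

    open TwoVariables _≟ᵛ_ P (fvar n2 r s) (fvar n3 r s) (λ ())

    family : Fin (2 ^ (k * k)) → BTVar k → Fin k
    -- The bit 0 becomes the index `zero`, which stands for the value 1, so `isOne` reads the bit
    -- back.
    family i (fvar zero a b)    = inject≤ (finToFun {2} {k * k} i (combine a b)) (s≤s (s≤s z≤n))
    -- This default never reaches the root: with the leaves below, f₂ and f₃ are evaluated at
    -- `(r , s)` only, where `assign` overrides it.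
    family i (fvar (suc _) _ _) = zero
    family i (leaf zero)                = r
    family i (leaf (suc zero))          = s
    family i (leaf (suc (suc zero)))    = r
    family i (leaf (suc (suc (suc _)))) = s

    assign-u : ∀ y a b → assign y a b (fvar n2 r s) ≡ a
    assign-u y a b rewrite dec-true (fvar n2 r s ≟ᵛ fvar n2 r s) refl = refl

    assign-v : ∀ y a b → assign y a b (fvar n3 r s) ≡ b
    assign-v y a b rewrite dec-true (fvar n3 r s ≟ᵛ fvar n3 r s) refl = refl

    BT-family : ∀ i a b →
                BT k (assign (family i) a b) ≡ isOne (finToFun {2} {k * k} i (combine a b))
    BT-family i a b rewrite assign-u (family i) a b | assign-v (family i) a b =
      isOne-inject≤ (finToFun {2} {k * k} i (combine a b)) (s≤s (s≤s z≤n))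

    crossing : List (Fin (nStates P))
    crossing = querying (fvar n2 r s) ++ querying (fvar n3 r s)

    crossing-unique : Unique crossing
    crossing-unique = Unique.++⁺ (querying-unique _) (querying-unique _) λ (∈u , ∈v) →
      contradiction (trans (sym (∈-querying⁻ ∈u)) (∈-querying⁻ ∈v)) λ ()

    crossing-label : ∀ {x} → x ∈ crossing → ∃ λ i → label P x ≡ inj₁ (fvar i r s)
    crossing-label x∈ =
      [ (λ ∈u → n2 , ∈-querying⁻ ∈u) , (λ ∈v → n3 , ∈-querying⁻ ∈v) ]′
        (∈-++⁻ (querying (fvar n2 r s)) x∈)

    k≤∣crossing∣² : 6 ≤ k → k ≤ length crossing * length crossing
    k≤∣crossing∣² 6≤k rewrite length-++ (querying (fvar n2 r s)) {querying (fvar n3 r s)} =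
      ≮⇒≥ λ m²<k → <⇒≱ (probeBound-small p q k 6≤k m²<k) (nečiporuk computes family BT-family)

  -- A state carries one label, and that label names the pair `(r , s)`.
  crossing-disjoint : ∀ {r s r′ s′ x} → x ∈ crossing r s → x ∈ crossing r′ s′ →
                      (r , s) ≡ (r′ , s′)
  crossing-disjoint x∈ x∈′
    with _ , l ← crossing-label _ _ x∈ | _ , l′ ← crossing-label _ _ x∈′
    with _ , refl , refl ← fvar-injective (inj₁-injective (trans (sym l) l′)) = refl

  state-bound : 6 ≤ k → k ^ 5 ≤ nStates P ^ 2
  state-bound 6≤k with t , k≤t² , least ← ⌈√ k ⌉ =
    k⁵≤n² k t (nStates P) k≤t² (disjoint-lists-bound {k * k} {t = t}
      (uncurry crossing ∘ remQuot k)
      (λ i → uncurry crossing-unique (remQuot k i))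
      (λ i j x x∈ x∈′ → trans (sym (Fin.combine-remQuot {k} k i))
        (trans (cong (uncurry combine) (crossing-disjoint x∈ x∈′)) (Fin.combine-remQuot {k} k j)))
      (λ i → least _ (uncurry k≤∣crossing∣² (remQuot k i) 6≤k)))

theorem5p6 : ∃ λ K → (k : ℕ) → K ≤ k → (P : NBP (BTVar k) k Bool) →
    Computes P (BT k) → k ^ 5 ≤ nStates P ^ 2
-- 6 is the threshold of `2+2m≤k`; it also ensures the `2 ≤ k` that 0/1-valued functions require.
theorem5p6 = 6 , λ { 1 (s≤s ()) ; (suc (suc k)) 6≤k P computes → state-bound P computes 6≤k }
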